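{- Let $(E,\mathscr{F})$ be an antimatroid on a finite ground set $E$, and let $P$ be the (join-distributive) lattice of its feasible sets, ordered by inclusion. The following statements are equivalent. 1. There exists a total order $\leq_E$ on $E$ with respect to which $(E,\mathscr{F},\leq_E)$ is a supersolvable antimatroid. 2. $P$ is a supersolvable lattice. 3. There exists a total order on $E$ with respect to which the natural edge-labelling of $P$ by $E$ is an $S_n$ EL-labelling.
   Context: A set system is a pair $(E,\mathscr{F})$ with $E$ a finite ground set and $\mathscr{F}\subseteq 2^E$ a collection of subsets called feasible sets. It is an antimatroid if $\emptyset\in\mathscr{F}$, every nonempty $A\in\mathscr{F}$ contains some $x$ with $A\setminus\{x\}\in\mathscr{F}$ (accessibility), and for all $A,B\in\mathscr{F}$ with $B\not\subseteq A$ there exists $x\in B\setminus A$ with $A\cup\{x\}\in\mathscr{F}$. Equivalently (given accessibility and $\emptyset\in\mathscr F$), $\mathscr{F}$ is closed under unions. The feasible sets ordered by inclusion form a lattice with join equal to union. Given a total order $\leq_E$ on $E$, $(E,\mathscr{F},\leq_E)$ is a supersolvable antimatroid if $\emptyset\in\mathscr{F}$ and for all $A,B\in\mathscr{F}$ with $B\not\subseteq A$, setting $x=\min_{\leq_E}(B\setminus A)$, one has $A\cup\{x\}\in\mathscr{F}$. A finite lattice is join-distributive if for every element $x$ and every set $Y$ of elements covering $x$ the interval $[x,\bigvee_{y\in Y}y]$ is boolean (isomorphic to the lattice of all subsets of a finite set). The lattice of feasible sets of an antimatroid is join-distributive. A finite lattice $P$ is supersolvable if it has a maximal chain $\mathfrak{m}$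 (an M-chain) such that for every maximal chain $\mathfrak{c}$ of $P$ the sublattice generated by $\mathfrak{m}\cup\mathfrak{c}$ is distributive. In the lattice $P$ of feasible sets of an antimatroid, every cover relation $X\prec Y$ satisfies $Y\setminus X=\{x\}$ for a single $x\in E$; the natural edge-labelling of $P$ by $E$ labels the edge $X\prec Y$ of the Hasse diagram by this $x$. An edge-labelling of a finite poset $P$ (with minimum and maximum) by a totally ordered set is an $S_n$ EL-labelling if: the labels along any maximal chain of $P$ form a permutation of one fixed $n$-element set of labels (which may be identified, as an ordered set, with $\{1,\dots,n\}$), and in every interval $[x,y]$ of $P$ there is exactly one maximal chain whose sequence of labels, read from bottom to top, is increasing. -}

module Defs where

open import Data.Empty using (⊥-elim)
open import Data.Fin.Base using (Fin)
open import Data.Fin.Subset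
  using (Subset; inside; outside; ⊥; ⁅_⁆; _∈_; _∉_; _⊆_; _⊈_; _⊃_; _∪_; _∩_; _─_; _-_; ⋃; Nonempty)
open import Data.Fin.Subset.Induction using (Acc; acc; ⊃-wellFounded)
open import Data.Fin.Subset.Properties
open import Data.List.Base using (List; []; _∷_; _++_; map; filter)
open import Data.List.Membership.Propositional using () renaming (_∈_ to _∈ˡ_)
open import Data.List.Membership.Propositional.Properties
  using (∈-map⁺; ∈-++⁺ˡ; ∈-++⁺ʳ; ∈-filter⁺)
open import Data.List.Relation.Binary.Permutation.Propositional using (_↭_)
open import Data.List.Relation.Binary.Pointwise using (Pointwise)
open import Data.List.Relation.Unary.All as All using (All; []; _∷_)
open import Data.List.Relation.Unary.All.Properties using (all-filter)
open import Data.List.Relation.Unary.Any using (here; there)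
open import Data.List.Relation.Unary.Linked using (Linked; []; [-]; _∷_)
open import Data.List.Relation.Unary.Linked.Properties using (Linked⇒All)
open import Data.List.Relation.Unary.Unique.Propositional using (Unique)
open import Data.Nat.Base using (ℕ; zero; suc)
open import Data.Product using (∃!)
open import Data.Product.Base using (Σ; ∃; _×_; _,_; proj₁; proj₂)
open import Data.Sum.Base using (_⊎_; inj₁; inj₂; [_,_]′)
import Data.Vec.Base as Vec
open import Function.Base using (_on_; _∘_)
open import Level using (Level; 0ℓ; _⊔_)
open import Relation.Binary.Bundles using (Poset)
open import Relation.Binary.Core using (Rel)
open import Relation.Binary.Lattice.Bundles using (Lattice)
open import Relation.Binary.Lattice.Structures using (IsDistributiveLattice)
open import Relation.Binary.PropositionalEquality.Core
  using (_≡_; refl; sym; trans; subst)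
import Relation.Binary.Construct.NonStrictToStrict as ToStrict
import Relation.Binary.Construct.On as On
import Relation.Binary.Properties.Poset as PosetProperties
open import Relation.Nullary.Decidable.Core using (yes; no; _×-dec_)
open import Relation.Nullary.Negation.Core using (¬_; contradiction)
open import Relation.Unary using (Pred; Decidable; U) renaming (_∪_ to _∪ₚ_)

private
  variable
    a c ℓ ℓ₁ ℓ₂ : Level
    n : ℕ

module _ (P : Poset c ℓ₁ ℓ₂) where

  open Poset P renaming (trans to ≤-trans)
  open PosetProperties P using (_<_; <⇒≱; <-trans)
  open import Data.List.Membership.Setoid Eq.setoid using () renaming (_∈_ to _∈ᶜ_)

  record Covers (x y : Carrier) : Set (c ⊔ ℓ₁ ⊔ ℓ₂) where
    constructor _,_
    field
      strict         : x < y
      nothingBetween : ∀ z → x < z → ¬ (z < y)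

  Interval : Carrier → Carrier → Pred Carrier ℓ₂
  Interval x y z = x ≤ z × z ≤ y

  -- A chain of a finite poset is listed from bottom to top.  Maximality is
  -- relative to the subposet I: either all of P (I = U) or an interval.
  record IsMaximalChain (I : Pred Carrier ℓ) (xs : List Carrier) : Set (c ⊔ ℓ ⊔ ℓ₁ ⊔ ℓ₂) where
    field
      within     : All I xs
      increasing : Linked _<_ xs
      maximal    : ∀ {z} → I z → All (λ x → z ≤ x ⊎ x ≤ z) xs → z ∈ᶜ xs

  Convex : Pred Carrier ℓ → Set (c ⊔ ℓ ⊔ ℓ₂)
  Convex I = ∀ {x y z} → I x → I y → x ≤ z → z ≤ y → I z

  U-convex : Convex U
  U-convex _ _ _ _ = _

  Interval-convex : ∀ {x y} → Convex (Interval x y)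
  Interval-convex (x≤u , _) (_ , v≤y) u≤z z≤v = ≤-trans x≤u u≤z , ≤-trans z≤v v≤y

  maximalChain⇒covers : ∀ {I : Pred Carrier ℓ} {xs} → Convex I →
                        IsMaximalChain I xs → Linked Covers xs
  maximalChain⇒covers {I = I} {xs} convex isMax =
    start xs (IsMaximalChain.within isMax) (IsMaximalChain.increasing isMax)
          (IsMaximalChain.maximal isMax)
    where
    Comparable : Carrier → Pred Carrier ℓ₂
    Comparable z x = z ≤ x ⊎ x ≤ z

    go : ∀ x ys → All I (x ∷ ys) → Linked _<_ (x ∷ ys) →
         (∀ {z} → I z → x ≤ z → All (Comparable z) ys → z ∈ᶜ (x ∷ ys)) →
         Linked Covers (x ∷ ys)
    go x []       _               _              _   = [-]
    go x (y ∷ ys) (Ix ∷ Iy ∷ Iys) (x<y ∷ y<ys) max =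
      (x<y , nothingBetween) ∷ go y ys (Iy ∷ Iys) y<ys max′
      where
      nothingBetween : ∀ z → x < z → ¬ (z < y)
      nothingBetween z x<z z<y
        with max (convex Ix Iy (proj₁ x<z) (proj₁ z<y)) (proj₁ x<z)
                 (All.map (inj₁ ∘ proj₁) (Linked⇒All <-trans z<y y<ys))
      ... | here z≈x        = contradiction (reflexive z≈x) (<⇒≱ x<z)
      ... | there (here z≈y) = proj₂ z<y z≈y
      ... | there (there z∈ys) = above z<y z∈ys y<ys
        where
        above : ∀ {z y ys} → z < y → z ∈ᶜ ys → ¬ Linked _<_ (y ∷ ys)
        above z<y (here z≈w)   (y<w ∷ _)   = <⇒≱ (<-trans z<y y<w) (reflexive (Eq.sym z≈w))
        above z<y (there z∈ys) (y<w ∷ w<ys) = above (<-trans z<y y<w) z∈ys w<ys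

      max′ : ∀ {z} → I z → y ≤ z → All (Comparable z) ys → z ∈ᶜ (y ∷ ys)
      max′ Iz y≤z cmp with max Iz (≤-trans (proj₁ x<y) y≤z) (inj₂ y≤z ∷ cmp)
      ... | here z≈x  = contradiction (≤-trans y≤z (reflexive z≈x)) (<⇒≱ x<y)
      ... | there z∈ = z∈

    start : ∀ xs → All I xs → Linked _<_ xs →
            (∀ {z} → I z → All (Comparable z) xs → z ∈ᶜ xs) → Linked Covers xs
    start []       _   _   _   = []
    start (x ∷ xs) Ixs x<xs max =
      go x xs Ixs x<xs (λ Iz x≤z cmp → max Iz (inj₂ x≤z ∷ cmp))

  record EdgeLabelling (Λ : Set a) : Set (a ⊔ c ⊔ ℓ₁ ⊔ ℓ₂) where
    field
      label      : ∀ {x y} → Covers x y → Λ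
      label-cong : ∀ {x y x′ y′} (e : Covers x y) (e′ : Covers x′ y′) →
                   x ≈ x′ → y ≈ y′ → label e ≡ label e′

    labels : ∀ {xs} → Linked Covers xs → List Λ
    labels []       = []
    labels [-]      = []
    labels (e ∷ es) = label e ∷ labels es

  -- _⊑_ is meant to be a total order; this is assumed separately where the
  -- definition is applied.  Asking for strictly increasing labels is no
  -- restriction, as labels along a maximal chain are distinct.
  record IsSnELLabelling {Λ : Set a} (_⊑_ : Rel Λ ℓ) (ℒ : EdgeLabelling Λ)
         : Set (a ⊔ c ⊔ ℓ ⊔ ℓ₁ ⊔ ℓ₂) where
    open EdgeLabelling ℒ
    open ToStrict _≡_ _⊑_ using () renaming (_<_ to _⊏_)
    field
      permutation :
        ∃ λ ls → Unique ls ×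
          (∀ {xs} (m : IsMaximalChain U xs) → labels (maximalChain⇒covers U-convex m) ↭ ls)
      uniqueIncreasing :
        ∀ {x y} → x ≤ y →
        ∃! (Pointwise _≈_) λ xs →
          Σ (IsMaximalChain (Interval x y) xs) λ m →
            Linked _⊏_ (labels (maximalChain⇒covers Interval-convex m))

module _ (L : Lattice c ℓ₁ ℓ₂) where

  open Lattice L
  open import Data.List.Membership.Setoid setoid using () renaming (_∈_ to _∈ᶜ_)

  data Generated (S : Pred Carrier ℓ) : Pred Carrier (c ⊔ ℓ) where
    gen  : ∀ {x} → S x → Generated S x
    _∨ᵍ_ : ∀ {x y} → Generated S x → Generated S y → Generated S (x ∨ y)
    _∧ᵍ_ : ∀ {x y} → Generated S x → Generated S y → Generated S (x ∧ y)

  sublattice : Pred Carrier ℓ → Lattice (c ⊔ ℓ) ℓ₁ ℓ₂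
  sublattice S = record
    { Carrier   = ∃ (Generated S)
    ; _≈_       = _≈_ on proj₁
    ; _≤_       = _≤_ on proj₁
    ; _∨_       = λ (x , gx) (y , gy) → (x ∨ y) , (gx ∨ᵍ gy)
    ; _∧_       = λ (x , gx) (y , gy) → (x ∧ y) , (gx ∧ᵍ gy)
    ; isLattice = record
      { isPartialOrder = On.isPartialOrder proj₁ isPartialOrder
      ; supremum       = λ (x , _) (y , _) →
          x≤x∨y x y , y≤x∨y x y , λ _ → ∨-least
      ; infimum        = λ (x , _) (y , _) →
          x∧y≤x x y , x∧y≤y x y , λ _ → ∧-greatest
      }
    }

  IsSupersolvableLattice : Set (c ⊔ ℓ₁ ⊔ ℓ₂)
  IsSupersolvableLattice =
    ∃ λ 𝔪 → IsMaximalChain poset U 𝔪 ×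
      (∀ 𝔠 → IsMaximalChain poset U 𝔠 →
        let module S = Lattice (sublattice ((_∈ᶜ 𝔪) ∪ₚ (_∈ᶜ 𝔠)))
        in IsDistributiveLattice S._≈_ S._≤_ S._∨_ S._∧_)

-- The ground set is Fin n.  A collection of subsets of a finite set is
-- given by a decidable predicate.
record SetSystem (n : ℕ) : Set₁ where
  field
    Feasible  : Pred (Subset n) 0ℓ
    feasible? : Decidable Feasible

module _ (𝓢 : SetSystem n) where

  open SetSystem 𝓢

  record IsAntimatroid : Set where
    field
      ∅-feasible : Feasible ⊥
      accessible : ∀ {A} → Feasible A → Nonempty A → ∃ λ x → x ∈ A × Feasible (A - x)
      exchange   : ∀ {A B} → Feasible A → Feasible B → B ⊈ A →
                   ∃ λ x → x ∈ B ─ A × Feasible (A ∪ ⁅ x ⁆)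

  IsMinimum : Rel (Fin n) ℓ → Subset n → Fin n → Set ℓ
  IsMinimum _≤_ A x = x ∈ A × (∀ {y} → y ∈ A → x ≤ y)

  -- As above, _≤_ is assumed separately to be a total order; the minimum x of
  -- B ─ A is then unique, and exists because B ⊈ A.
  record IsSupersolvableAntimatroid (_≤_ : Rel (Fin n) ℓ) : Set ℓ where
    field
      ∅-feasible  : Feasible ⊥
      minExchange : ∀ {A B} → Feasible A → Feasible B → B ⊈ A →
                    ∀ {x} → IsMinimum _≤_ (B ─ A) x → Feasible (A ∪ ⁅ x ⁆)

x∈p─q⇒x∉q : ∀ {x} (p q : Subset n) → x ∈ p ─ q → x ∉ q
x∈p─q⇒x∉q (_ Vec.∷ p) (_ Vec.∷ q) (Vec.there x∈) (Vec.there x∈q) = x∈p─q⇒x∉q p q x∈ x∈q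
x∈p─q⇒x∉q (_ Vec.∷ p) (inside Vec.∷ q) () Vec.here

⁅x⁆⊆p : ∀ {x} {p : Subset n} → x ∈ p → ⁅ x ⁆ ⊆ p
⁅x⁆⊆p {x = x} {p} x∈p y∈ = subst (_∈ p) (sym (x∈⁅y⁆⇒x≡y x y∈)) x∈p

∪-least : ∀ {p q r : Subset n} → p ⊆ r → q ⊆ r → p ∪ q ⊆ r
∪-least {p = p} {q} p⊆r q⊆r x∈ = [ p⊆r , q⊆r ]′ (x∈p∪q⁻ p q x∈)

subsets : ∀ n → List (Subset n)
subsets zero    = Vec.[] ∷ []
subsets (suc n) = map (outside Vec.∷_) (subsets n) ++ map (inside Vec.∷_) (subsets n)

∈-subsets : ∀ (p : Subset n) → p ∈ˡ subsets n
∈-subsets Vec.[]              = here refl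
∈-subsets (outside Vec.∷ p) = ∈-++⁺ˡ (∈-map⁺ _ (∈-subsets p))
∈-subsets (inside  Vec.∷ p) = ∈-++⁺ʳ _ (∈-map⁺ _ (∈-subsets p))

module _ {𝓢 : SetSystem n} (isAntimatroid : IsAntimatroid 𝓢) where

  open SetSystem 𝓢
  open IsAntimatroid isAntimatroid

  ∪-feasible : ∀ {A B} → Feasible A → Feasible B → Feasible (A ∪ B)
  ∪-feasible {A} {B} fA fB = go A fA (⊃-wellFounded A)
    where
    go : ∀ A → Feasible A → Acc _⊃_ A → Feasible (A ∪ B)
    go A fA (acc rec) with B ⊆? A
    ... | yes B⊆A = subst Feasible
                      (⊆-antisym (p⊆p∪q B) (∪-least ⊆-refl B⊆A)) fA
    ... | no  B⊈A with exchange fA fB B⊈A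
    ...   | x , x∈B─A , fA∪x = subst Feasible (⊆-antisym ⊆₁ ⊆₂)
            (go (A ∪ ⁅ x ⁆) fA∪x
              (rec (p⊆p∪q ⁅ x ⁆ , x , q⊆p∪q A ⁅ x ⁆ (x∈⁅x⁆ x) , x∈p─q⇒x∉q B A x∈B─A)))
      where
      ⊆₁ : (A ∪ ⁅ x ⁆) ∪ B ⊆ A ∪ B
      ⊆₁ = ∪-least (∪-least (p⊆p∪q B) (⁅x⁆⊆p (q⊆p∪q A B (p─q⊆p B A x∈B─A)))) (q⊆p∪q A B)
      ⊆₂ : A ∪ B ⊆ (A ∪ ⁅ x ⁆) ∪ B
      ⊆₂ = ∪-least (p⊆p∪q B ∘ p⊆p∪q ⁅ x ⁆) (q⊆p∪q (A ∪ ⁅ x ⁆) B)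

  feasibleIn? : ∀ C → Decidable (λ A → Feasible A × A ⊆ C)
  feasibleIn? C A = feasible? A ×-dec A ⊆? C

  interior : Subset n → Subset n
  interior C = ⋃ (filter (feasibleIn? C) (subsets n))

  interior-feasible : ∀ C → Feasible (interior C)
  interior-feasible C = go (All.map proj₁ (all-filter (feasibleIn? C) (subsets n)))
    where
    go : ∀ {As} → All Feasible As → Feasible (⋃ As)
    go []         = ∅-feasible
    go (fA ∷ fAs) = ∪-feasible fA (go fAs)

  interior⊆ : ∀ C → interior C ⊆ C
  interior⊆ C = go (all-filter (feasibleIn? C) (subsets n))
    where
    go : ∀ {As} → All (λ A → Feasible A × A ⊆ C) As → ⋃ As ⊆ C
    go []                 = ⊆-min C
    go ((_ , A⊆C) ∷ pAs) = ∪-least A⊆C (go pAs)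

  interior-greatest : ∀ {A C} → Feasible A → A ⊆ C → A ⊆ interior C
  interior-greatest {A} {C} fA A⊆C = go (∈-filter⁺ (feasibleIn? C) (∈-subsets A) (fA , A⊆C))
    where
    go : ∀ {As} → A ∈ˡ As → A ⊆ ⋃ As
    go (here refl) = p⊆p∪q _
    go (there A∈)  = q⊆p∪q _ _ ∘ go A∈

  -- The meet is the largest feasible subset of the intersection, which
  -- need not itself be feasible.
  feasibleLattice : Lattice 0ℓ 0ℓ 0ℓ
  feasibleLattice = record
    { Carrier   = ∃ Feasible
    ; _≈_       = _≡_ on proj₁
    ; _≤_       = _⊆_ on proj₁
    ; _∨_       = λ (A , fA) (B , fB) → A ∪ B , ∪-feasible fA fB
    ; _∧_       = λ (A , _) (B , _) → interior (A ∩ B) , interior-feasible (A ∩ B)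
    ; isLattice = record
      { isPartialOrder = On.isPartialOrder proj₁ (⊆-isPartialOrder n)
      ; supremum       = λ (A , _) (B , _) →
          p⊆p∪q B , q⊆p∪q A B , λ _ → ∪-least
      ; infimum        = λ (A , _) (B , _) →
          p∩q⊆p A B ∘ interior⊆ (A ∩ B) ,
          p∩q⊆q A B ∘ interior⊆ (A ∩ B) ,
          λ (C , fC) C⊆A C⊆B →
            interior-greatest fC (λ x∈C → x∈p∩q⁺ (C⊆A x∈C , C⊆B x∈C))
      }
    }

  feasiblePoset : Poset 0ℓ 0ℓ 0ℓ
  feasiblePoset = Lattice.poset feasibleLattice

  cover⇒singleton : ∀ {X Y} → Covers feasiblePoset X Y →
                    ∃ λ x → proj₁ Y ─ proj₁ X ≡ ⁅ x ⁆
  cover⇒singleton {X , fX} {Y , fY} ((X⊆Y , X≢Y) , noneBetween)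
    with exchange fX fY (λ Y⊆X → X≢Y (⊆-antisym X⊆Y Y⊆X))
  ... | x , x∈Y─X , fX∪x = x , ⊆-antisym Y─X⊆x (⁅x⁆⊆p x∈Y─X)
    where
    x∉X : x ∉ X
    x∉X = x∈p─q⇒x∉q Y X x∈Y─X

    X∪x⊆Y : X ∪ ⁅ x ⁆ ⊆ Y
    X∪x⊆Y = ∪-least X⊆Y (⁅x⁆⊆p (p─q⊆p Y X x∈Y─X))

    X≢X∪x : ¬ X ≡ X ∪ ⁅ x ⁆
    X≢X∪x eq = x∉X (subst (x ∈_) (sym eq) (q⊆p∪q X ⁅ x ⁆ (x∈⁅x⁆ x)))

    Y⊆X∪x : Y ⊆ X ∪ ⁅ x ⁆
    Y⊆X∪x {y} y∈Y with y ∈? X ∪ ⁅ x ⁆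
    ... | yes y∈ = y∈
    ... | no  y∉ = ⊥-elim (noneBetween (X ∪ ⁅ x ⁆ , fX∪x)
      (p⊆p∪q ⁅ x ⁆ , X≢X∪x)
      (X∪x⊆Y , λ eq → y∉ (subst (y ∈_) (sym eq) y∈Y)))

    Y─X⊆x : Y ─ X ⊆ ⁅ x ⁆
    Y─X⊆x y∈ with x∈p∪q⁻ X ⁅ x ⁆ (Y⊆X∪x (p─q⊆p Y X y∈))
    ... | inj₁ y∈X = contradiction y∈X (x∈p─q⇒x∉q Y X y∈)
    ... | inj₂ y∈x = y∈x

  naturalLabelling : EdgeLabelling feasiblePoset (Fin n)
  naturalLabelling = record
    { label      = λ e → proj₁ (cover⇒singleton e)
    ; label-cong = λ { {_ , _} {_ , _} {_ , _} {_ , _} e e′ refl refl →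
        let x , eq = cover⇒singleton e
            y , eq′ = cover⇒singleton e′
        in x∈⁅y⁆⇒x≡y y (subst (x ∈_) (trans (sym eq) eq′) (x∈⁅x⁆ x)) }
    }

{-# OPTIONS --safe #-}
module Submission where

-- For a supersolvable antimatroid, adding the minimum of B \ A again and again
-- gives the unique increasing chain from A to B; conversely the first label of
-- the increasing chain of [A , A ∪ B] is min (B \ A).
--
-- Its increasing maximal chain is an M-chain: initial segments M of the order
-- satisfy M ∧ C = M ∩ C, so the lattice generated with a chain 𝔠 consists of
-- unions of sets M ∩ C, on which ∧ and ∨ are ∩ and ∪.
--
-- Conversely, order E by entry into an M-chain.  If x = min (B \ A) is added in
-- the M-chain by M′ ⋖ M, then B ∩ M ⊆ A ∪ {x}, and it suffices that x ∈ B ∧ M,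
-- since then A ∪ {x} = A ∪ (B ∧ M).  If C′ ⋖ C ⊆ B adds x in a maximal chain
-- through B, then with J = C′ ∪ M′ ∌ x distributivity gives
-- J ∨ (C ∧ M) = (J ∨ C) ∧ (J ∨ M) ∋ x, hence x ∈ C ∧ M.

open import Defs
import Data.Bool.Properties as Bool
open import Data.Empty using (⊥-elim)
open import Data.Fin.Base using (Fin)
import Data.Fin.Base as Fin
open import Data.Fin.Properties using () renaming (≤-isTotalOrder to Fin-≤-isTotalOrder)
open import Data.Fin.Subset
  using (Subset; ⊤; ⊥; ⁅_⁆; _∈_; _∉_; _⊆_; _⊈_; _⊃_; _∪_; _∩_; _─_; Nonempty)
open import Data.Fin.Subset.Induction using (Acc; acc; ⊃-wellFounded)
open import Data.Fin.Subset.Properties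
open import Data.List.Base using (List; []; _∷_; filter; length; allFin)
open import Data.List.Extrema using (min; argmin-all; min≤xs)
open import Data.List.Membership.Propositional using () renaming (_∈_ to _∈ˡ_)
open import Data.List.Membership.Propositional.Properties using (∈-filter⁺; ∈-filter⁻; ∈-allFin)
open import Data.List.Membership.Propositional.Properties.WithK using (unique∧set⇒bag)
open import Data.List.Relation.Binary.BagAndSetEquality using (∼bag⇒↭)
open import Data.List.Relation.Binary.Permutation.Propositional using (_↭_)
open import Data.List.Relation.Binary.Pointwise using (Pointwise; []; _∷_)
open import Data.List.Relation.Unary.All as All using (All; []; _∷_)
open import Data.List.Relation.Unary.All.Properties using (all-filter)
open import Data.List.Relation.Unary.AllPairs using ([]; _∷_)
open import Data.List.Relation.Unary.Any as Any using (Any; here; there)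
open import Data.List.Relation.Unary.Linked as Linked using (Linked; []; [-]; _∷_)
open import Data.List.Relation.Unary.Linked.Properties using (Linked⇒All)
open import Data.List.Relation.Unary.Unique.Propositional using (Unique)
open import Data.List.Relation.Unary.Unique.Propositional.Properties using (allFin⁺; filter⁺)
open import Data.Nat.Base using (ℕ; _<_; _≤_; z≤n; s≤s)
import Data.Nat.Properties as ℕ
open import Data.Product.Base using (Σ; ∃; _×_; _,_; proj₁; proj₂)
open import Data.Product.Relation.Binary.Lex.NonStrict using (×-Lex; ×-isTotalOrder)
open import Data.Sum.Base using (_⊎_; inj₁; inj₂)
open import Data.Vec.Properties using (≡-dec)
open import Function.Base using (_∘_)
open import Function.Bundles using (_⇔_; mk⇔)
open import Function.Construct.Composition using (_⇔-∘_)
open import Function.Construct.Symmetry using (⇔-sym)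
open import Level using (Level; 0ℓ; _⊔_)
open import Relation.Binary.Bundles using (Poset; TotalOrder)
import Relation.Binary.Construct.NonStrictToStrict as ToStrict
open import Relation.Binary.Core using (Rel)
import Relation.Binary.Definitions as B
open import Relation.Binary.Lattice.Bundles using (Lattice; DistributiveLattice)
import Relation.Binary.Lattice.Properties.DistributiveLattice as DistributiveLatticeProperties
open import Relation.Binary.Lattice.Structures using (IsDistributiveLattice)
import Relation.Binary.Morphism.OrderMonomorphism as OrderMonomorphism
import Relation.Binary.Properties.Poset as PosetProperties
open import Relation.Binary.PropositionalEquality.Core
  using (_≡_; refl; sym; trans; cong; cong₂; subst)
open import Relation.Binary.Structures using (IsTotalOrder)
open import Relation.Nullary.Decidable.Core using (yes; no; ¬?)
open import Relation.Nullary.Negation.Core using (¬_; contradiction)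
open import Relation.Unary using (Pred; Decidable; U) renaming (_∪_ to _∪ₚ_)

private
  variable
    a c p q ℓ ℓ₁ ℓ₂ : Level
    A : Set a
    n : ℕ

-- Saturated and maximal chains in a poset.

module ChainProperties (P : Poset c ℓ₁ ℓ₂) where

  open Poset P renaming (_≤_ to _≼_; refl to ≼-refl; trans to ≼-trans)
  open PosetProperties P using (<⇒≱) renaming (_<_ to _≺_)
  open import Data.List.Membership.Setoid Eq.setoid using () renaming (_∈_ to _∈ᶜ_)

  data EndsAt (b : Carrier) : List Carrier → Set (c ⊔ ℓ₁) where
    last : ∀ {x} → x ≈ b → EndsAt b (x ∷ [])
    next : ∀ {x y xs} → EndsAt b (y ∷ xs) → EndsAt b (x ∷ y ∷ xs)

  covers⇒increasing : ∀ {xs} → Linked (Covers P) xs → Linked _≺_ xs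
  covers⇒increasing = Linked.map Covers.strict

  head-minimum : ∀ {x xs y} → Linked _≺_ (x ∷ xs) → y ∈ᶜ (x ∷ xs) → x ≼ y
  head-minimum _           (here y≈x)  = reflexive (Eq.sym y≈x)
  head-minimum (x≺z ∷ inc) (there y∈) = ≼-trans (proj₁ x≺z) (head-minimum inc y∈)

  comparable : ∀ {xs x y} → Linked _≺_ xs → x ∈ᶜ xs → y ∈ᶜ xs → x ≼ y ⊎ y ≼ x
  comparable inc (here x≈z) y∈ = inj₁ (≼-trans (reflexive x≈z) (head-minimum inc y∈))
  comparable inc x∈@(there _) (here y≈z) = inj₂ (≼-trans (reflexive y≈z) (head-minimum inc x∈))
  comparable inc (there x∈) (there y∈) = comparable (Linked.tail inc) x∈ y∈

  endsAt⇒∈ : ∀ {b xs} → EndsAt b xs → b ∈ᶜ xs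
  endsAt⇒∈ (last x≈b) = here (Eq.sym x≈b)
  endsAt⇒∈ (next e)   = there (endsAt⇒∈ e)

  endsAt⇒bounded : ∀ {b xs} → Linked _≺_ xs → EndsAt b xs → All (_≼ b) xs
  endsAt⇒bounded _ (last x≈b) = reflexive x≈b ∷ []
  endsAt⇒bounded (x≺y ∷ inc) (next e) with endsAt⇒bounded inc e
  ... | y≼b ∷ bounded = ≼-trans (proj₁ x≺y) y≼b ∷ y≼b ∷ bounded

  bounded∧∈⇒endsAt : ∀ {b xs} → Linked _≺_ xs → All (_≼ b) xs → b ∈ᶜ xs → EndsAt b xs
  bounded∧∈⇒endsAt [-] _ (here b≈x) = last (Eq.sym b≈x)
  bounded∧∈⇒endsAt (x≺y ∷ _) (_ ∷ y≼b ∷ _) (here b≈x) =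
    contradiction (≼-trans y≼b (reflexive b≈x)) (<⇒≱ x≺y)
  bounded∧∈⇒endsAt (_ ∷ inc) (_ ∷ bounded) (there b∈) = next (bounded∧∈⇒endsAt inc bounded b∈)

  -- The bound `x` is comparable with everything in the interval, so maximality puts it into the
  -- chain, where it can only come first. The list is given by an equation so that matching on it
  -- brings the chain into the form `x ∷ xs`.
  maximalChain-head : ∀ x y {xs} → x ≼ y → IsMaximalChain P (Interval P x y) xs →
                      ∃ λ x′ → ∃ λ xs′ → xs ≡ x′ ∷ xs′ × x′ ≈ x
  maximalChain-head x y x≼y isMax =
    split (maximal (≼-refl , x≼y) (All.map (inj₁ ∘ proj₁) within)) within increasing
    where
    open IsMaximalChain isMax
    split : ∀ {xs} → x ∈ᶜ xs → All (Interval P x y) xs → Linked _≺_ xs →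
            ∃ λ x′ → ∃ λ xs′ → xs ≡ x′ ∷ xs′ × x′ ≈ x
    split {x′ ∷ xs′} x∈ ((x≼x′ , _) ∷ _) inc =
      x′ , xs′ , _≡_.refl , antisym (head-minimum inc x∈) x≼x′

  maximalChain-endsAt : ∀ x y {xs} → x ≼ y → IsMaximalChain P (Interval P x y) xs → EndsAt y xs
  maximalChain-endsAt x y x≼y isMax =
    bounded∧∈⇒endsAt increasing (All.map proj₂ within)
      (maximal (x≼y , ≼-refl) (All.map (inj₂ ∘ proj₂) within))
    where open IsMaximalChain isMax

  module _ (_≟_ : B.Decidable _≈_) where

    -- Climb the chain as long as its members lie below `z`. At the first step `x ⋖ y` with `z ≼ y`,
    -- the element `z` is trapped between `x` and `y`, and decidable equality turns this into
    -- `z ≈ x` or `z ≈ y`.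
    covers⇒∈ : ∀ {b x xs z} → Linked (Covers P) (x ∷ xs) → EndsAt b (x ∷ xs) →
               x ≼ z → z ≼ b → All (λ y → z ≼ y ⊎ y ≼ z) xs → z ∈ᶜ (x ∷ xs)
    covers⇒∈ [-] (last x≈b) x≼z z≼b _ =
      here (antisym (≼-trans z≼b (reflexive (Eq.sym x≈b))) x≼z)
    covers⇒∈ (_ ∷ cs) (next e) x≼z z≼b (inj₂ y≼z ∷ cmp) = there (covers⇒∈ cs e y≼z z≼b cmp)
    covers⇒∈ {x = x} {y ∷ _} {z} (x⋖y ∷ _) _ x≼z z≼b (inj₁ z≼y ∷ _) with z ≟ x | z ≟ y
    ... | yes z≈x | _       = here z≈x
    ... | no _    | yes z≈y = there (here z≈y)
    ... | no z≉x  | no z≉y  =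
      contradiction (z≼y , z≉y) (Covers.nothingBetween x⋖y z (x≼z , z≉x ∘ Eq.sym))

    covers⇒maximalChain : ∀ {x b xs} → Linked (Covers P) (x ∷ xs) → EndsAt b (x ∷ xs) →
                          IsMaximalChain P (Interval P x b) (x ∷ xs)
    covers⇒maximalChain {x} {b} cs e = record
      { within     = All.zip (above (covers⇒increasing cs) , endsAt⇒bounded (covers⇒increasing cs) e)
      ; increasing = covers⇒increasing cs
      ; maximal    = λ { (x≼z , z≼b) (_ ∷ cmp) → covers⇒∈ cs e x≼z z≼b cmp }
      }
      where
      above : ∀ {x xs} → Linked _≺_ (x ∷ xs) → All (x ≼_) (x ∷ xs)
      above [-]         = ≼-refl ∷ []
      above (x≺y ∷ inc) = ≼-refl ∷ All.map (≼-trans (proj₁ x≺y)) (above inc)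

  module _ {Λ : Set a} (ℒ : EdgeLabelling P Λ) where
    open EdgeLabelling ℒ

    -- An EL-labelling reads its covers off a proof of maximality, whereas chains constructed step
    -- by step come with covers of their own; this identifies the two label sequences.
    labels-irrelevant : ∀ {xs} (cs ds : Linked (Covers P) xs) → labels cs ≡ labels ds
    labels-irrelevant []       []       = _≡_.refl
    labels-irrelevant [-]      [-]      = _≡_.refl
    labels-irrelevant (e ∷ cs) (f ∷ ds) =
      cong₂ _∷_ (label-cong e f Eq.refl Eq.refl) (labels-irrelevant cs ds)

-- Counting by filters, and total orders from ranking functions.

filter-length-≤ : ∀ {P : Pred A p} {Q : Pred A q} (P? : Decidable P) (Q? : Decidable Q) {xs} →
                  All (λ x → P x → Q x) xs → length (filter P? xs) ≤ length (filter Q? xs)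
filter-length-≤ P? Q? [] = z≤n
filter-length-≤ P? Q? {x ∷ _} (P⇒Q ∷ rest) with P? x | Q? x
... | yes Px | yes Qx = s≤s (filter-length-≤ P? Q? rest)
... | yes Px | no ¬Qx = contradiction (P⇒Q Px) ¬Qx
... | no ¬Px | yes Qx = ℕ.m≤n⇒m≤1+n (filter-length-≤ P? Q? rest)
... | no ¬Px | no ¬Qx = filter-length-≤ P? Q? rest

filter-length-< : ∀ {P : Pred A p} {Q : Pred A q} (P? : Decidable P) (Q? : Decidable Q) {xs} →
                  All (λ x → P x → Q x) xs → Any (λ x → ¬ P x × Q x) xs →
                  length (filter P? xs) < length (filter Q? xs)
filter-length-< P? Q? {x ∷ _} (P⇒Q ∷ rest) (here (¬Px , Qx)) with P? x | Q? x
... | yes Px | _      = contradiction Px ¬Px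
... | no _   | yes _  = s≤s (filter-length-≤ P? Q? rest)
... | no _   | no ¬Qx = contradiction Qx ¬Qx
filter-length-< P? Q? {x ∷ _} (P⇒Q ∷ rest) (there some) with P? x | Q? x
... | yes Px | yes Qx = s≤s (filter-length-< P? Q? rest some)
... | yes Px | no ¬Qx = contradiction (P⇒Q Px) ¬Qx
... | no ¬Px | yes Qx = ℕ.m≤n⇒m≤1+n (filter-length-< P? Q? rest some)
... | no ¬Px | no ¬Qx = filter-length-< P? Q? rest some

-- The lexicographic order pulled back along `x ↦ (r x , x)`. The second coordinate makes this map
-- injective, so the order is antisymmetric even where `r` takes equal values.
TieBroken : (Fin n → ℕ) → Rel (Fin n) 0ℓ
TieBroken r x y = ×-Lex _≡_ _≤_ Fin._≤_ (r x , x) (r y , y)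

tieBroken⇒≤ : ∀ {r : Fin n → ℕ} {x y} → TieBroken r x y → r x ≤ r y
tieBroken⇒≤ (inj₁ (rx≤ry , _)) = rx≤ry
tieBroken⇒≤ (inj₂ (rx≡ry , _)) = ℕ.≤-reflexive rx≡ry

tieBroken-isTotalOrder : (r : Fin n → ℕ) → IsTotalOrder _≡_ (TieBroken r)
tieBroken-isTotalOrder r = OrderMonomorphism.isTotalOrder
  (record
    { isOrderHomomorphism = record
      { cong = λ { refl → refl , refl }
      ; mono = λ x≤y → x≤y
      }
    ; injective = proj₂
    ; cancel    = λ x≤y → x≤y
    })
  (×-isTotalOrder ℕ._≟_ ℕ.≤-isTotalOrder Fin-≤-isTotalOrder)

-- Minima of nonempty subsets.

⊈⇒nonempty-─ : ∀ {A B : Subset n} → B ⊈ A → Nonempty (B ─ A)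
⊈⇒nonempty-─ {A = A} {B} B⊈A with nonempty? (B ─ A)
... | yes ne = ne
... | no  em = ⊥-elim (B⊈A B⊆A)
  where
  B⊆A : B ⊆ A
  B⊆A {x} x∈B with x ∈? A
  ... | yes x∈A = x∈A
  ... | no  x∉A = contradiction (x , x∈p∧x∉q⇒x∈p─q x∈B x∉A) em

module _ (𝓢 : SetSystem n) {_⊑_ : Rel (Fin n) ℓ} (isTotalOrder : IsTotalOrder _≡_ _⊑_) where

  ∃-minimum : ∀ {A} → Nonempty A → ∃ (IsMinimum 𝓢 _⊑_ A)
  ∃-minimum {A} (x , x∈A) =
      -- The default value `x` lies in `A`, so the result does too, whichever candidate attains the
      -- minimum.
      min O x elems
    , argmin-all O (λ y → y) x∈A (all-filter (_∈? A) (allFin n))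
    , λ y∈A → All.lookup (min≤xs O x elems) (∈-filter⁺ (_∈? A) (∈-allFin _) y∈A)
    where
    O : TotalOrder _ _ _
    O = record { isTotalOrder = isTotalOrder }
    elems : List (Fin n)
    elems = filter (_∈? A) (allFin n)

_∷ᴸ_ : ∀ {R : Rel A ℓ} {x ys} → All (R x) ys → Linked R ys → Linked R (x ∷ ys)
[]        ∷ᴸ _  = [-]
(r ∷ _)   ∷ᴸ rs = r ∷ rs

-- Covers, natural labels and maximal chains of feasible sets.

module _ {𝓢 : SetSystem n} (am : IsAntimatroid 𝓢) where

  open SetSystem 𝓢
  open IsAntimatroid am
  open PosetProperties (feasiblePoset am) using () renaming (_<_ to _≺_)
  open ChainProperties (feasiblePoset am)
  open EdgeLabelling (naturalLabelling am)
  open Poset (feasiblePoset am) using (_≈_; module Eq) renaming (Carrier to Feasibles)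
  open import Data.List.Membership.Setoid Eq.setoid using () renaming (_∈_ to _∈ᶜ_)

  _⋖_ : Rel Feasibles 0ℓ
  _⋖_ = Covers (feasiblePoset am)

  _≟ᶠ_ : B.Decidable _≈_
  (X , _) ≟ᶠ (Y , _) = ≡-dec Bool._≟_ X Y

  difference : ∀ {X Y} (e : X ⋖ Y) → proj₁ Y ─ proj₁ X ≡ ⁅ label e ⁆
  difference e = proj₂ (cover⇒singleton am e)

  label∈ : ∀ {X Y} (e : X ⋖ Y) → label e ∈ proj₁ Y
  label∈ {X , _} {Y , _} e = p─q⊆p Y X (subst (label e ∈_) (sym (difference e)) (x∈⁅x⁆ (label e)))

  label∉ : ∀ {X Y} (e : X ⋖ Y) → label e ∉ proj₁ X
  label∉ {X , _} {Y , _} e =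
    x∈p─q⇒x∉q Y X (subst (label e ∈_) (sym (difference e)) (x∈⁅x⁆ (label e)))

  ≡-label : ∀ {X Y z} (e : X ⋖ Y) → z ∈ proj₁ Y → z ∉ proj₁ X → z ≡ label e
  ≡-label {z = z} e z∈Y z∉X =
    x∈⁅y⁆⇒x≡y (label e) (subst (z ∈_) (difference e) (x∈p∧x∉q⇒x∈p─q z∈Y z∉X))

  ∪-singleton-covers : ∀ {A x} (fA : Feasible A) (fA∪x : Feasible (A ∪ ⁅ x ⁆)) → x ∉ A →
                       (A , fA) ⋖ (A ∪ ⁅ x ⁆ , fA∪x)
  ∪-singleton-covers {A} {x} fA fA∪x x∉A =
    (p⊆p∪q ⁅ x ⁆ , λ eq → x∉A (subst (x ∈_) (sym eq) (q⊆p∪q A ⁅ x ⁆ (x∈⁅x⁆ x)))) , between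
    where
    between : ∀ Z → (A , fA) ≺ Z → ¬ (Z ≺ (A ∪ ⁅ x ⁆ , fA∪x))
    between (Z , _) (A⊆Z , A≢Z) (Z⊆A∪x , Z≢A∪x) with x ∈? Z
    ... | yes x∈Z = Z≢A∪x (⊆-antisym Z⊆A∪x (∪-least A⊆Z (⁅x⁆⊆p x∈Z)))
    ... | no  x∉Z = A≢Z (⊆-antisym A⊆Z Z⊆A)
      where
      Z⊆A : Z ⊆ A
      Z⊆A z∈Z with x∈p∪q⁻ A ⁅ x ⁆ (Z⊆A∪x z∈Z)
      ... | inj₁ z∈A = z∈A
      ... | inj₂ z∈x = contradiction (subst (_∈ Z) (x∈⁅y⁆⇒x≡y x z∈x) z∈Z) x∉Z

  ends⊇ : ∀ {X xs B} → Linked _⋖_ (X ∷ xs) → EndsAt B (X ∷ xs) → proj₁ X ⊆ proj₁ B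
  ends⊇ cs e = All.head (endsAt⇒bounded (covers⇒increasing cs) e)

  -- Together with `labels⁺` and `labels-unique`: the labels of a saturated chain list `B ─ X`
  -- without repetition. Two such chains with the same ends can therefore differ only in the order
  -- of their labels.
  labels⁻ : ∀ {X xs B} (cs : Linked _⋖_ (X ∷ xs)) → EndsAt B (X ∷ xs) →
            All (λ z → z ∈ proj₁ B × z ∉ proj₁ X) (labels cs)
  labels⁻ [-] _ = []
  labels⁻ (c ∷ cs) (next e) =
    (ends⊇ cs e (label∈ c) , label∉ c) ∷
    All.map (λ (z∈B , z∉Y) → z∈B , z∉Y ∘ proj₁ (Covers.strict c)) (labels⁻ cs e)

  labels⁺ : ∀ {X xs B z} (cs : Linked _⋖_ (X ∷ xs)) → EndsAt B (X ∷ xs) →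
            z ∈ proj₁ B → z ∉ proj₁ X → z ∈ˡ labels cs
  labels⁺ [-] (last X≡B) z∈B z∉X = contradiction (subst (_ ∈_) (sym X≡B) z∈B) z∉X
  labels⁺ {xs = Y ∷ _} {z = z} (c ∷ cs) (next e) z∈B z∉X with z ∈? proj₁ Y
  ... | yes z∈Y = here (≡-label c z∈Y z∉X)
  ... | no  z∉Y = there (labels⁺ cs e z∈B z∉Y)

  labels-unique : ∀ {X xs B} (cs : Linked _⋖_ (X ∷ xs)) → EndsAt B (X ∷ xs) → Unique (labels cs)
  labels-unique [-] _ = []
  labels-unique (c ∷ cs) (next e) =
    All.map (λ { (_ , z∉Y) refl → z∉Y (label∈ c) }) (labels⁻ cs e) ∷ labels-unique cs e

  -- The maximum of the lattice is the union of all feasible sets; the whole ground set need not be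
  -- feasible.
  top : Feasibles
  top = interior am ⊤ , interior-feasible am ⊤

  ⊆top : ∀ (A : Feasibles) → proj₁ A ⊆ proj₁ top
  ⊆top (A , fA) = interior-greatest am fA ⊆⊤

  bottom : Feasibles
  bottom = ⊥ , ∅-feasible

  -- Every feasible set lies between `bottom` and `top`, so the lemmas on heads and ends of chains
  -- in intervals apply to maximal chains of the whole poset.
  maximalChain-bounds : ∀ {xs} → IsMaximalChain (feasiblePoset am) U xs →
                        IsMaximalChain (feasiblePoset am) (Interval (feasiblePoset am) bottom top) xs
  maximalChain-bounds isMax = record
    { within     = All.map (λ {X} _ → ⊆-min (proj₁ X) , ⊆top X) within
    ; increasing = increasing
    ; maximal    = λ {z} _ → maximal {z} _
    }
    where open IsMaximalChain isMax

  endsAtTop⇒maximalChain : ∀ {xs} → Linked _⋖_ (bottom ∷ xs) → EndsAt top (bottom ∷ xs) →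
                           IsMaximalChain (feasiblePoset am) U (bottom ∷ xs)
  endsAtTop⇒maximalChain cs e = record
    { within     = All.map (λ _ → _) within
    ; increasing = increasing
    ; maximal    = λ {Z} _ → maximal {Z} (⊆-min (proj₁ Z) , ⊆top Z)
    }
    where open IsMaximalChain (covers⇒maximalChain _≟ᶠ_ cs e)

  -- Two repetition-free lists with the same members are permutations of each other, and both lists
  -- here enumerate `top`. The covers `cs` are arbitrary, so that the list can be matched against
  -- its head `bottom`.
  labels-permutation : ∀ {xs} → IsMaximalChain (feasiblePoset am) U xs → (cs : Linked _⋖_ xs) →
                       labels cs ↭ filter (_∈? proj₁ top) (allFin n)
  labels-permutation isMax cs
    with isMax′ ← maximalChain-bounds isMax
    with e ← maximalChain-endsAt bottom top (⊆-min (proj₁ top)) isMax′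
    with _ , _ , refl , refl ← maximalChain-head bottom top (⊆-min (proj₁ top)) isMax′
    = ∼bag⇒↭ (unique∧set⇒bag (labels-unique cs e) (filter⁺ (_∈? proj₁ top) {allFin n} (allFin⁺ n)) (mk⇔ to from))
    where
    to : ∀ {z} → z ∈ˡ labels cs → z ∈ˡ filter (_∈? proj₁ top) (allFin n)
    to z∈ = ∈-filter⁺ (_∈? proj₁ top) (∈-allFin _) (proj₁ (All.lookup (labels⁻ cs e) z∈))
    from : ∀ {z} → z ∈ˡ filter (_∈? proj₁ top) (allFin n) → z ∈ˡ labels cs
    from z∈ = labels⁺ cs e (proj₂ (∈-filter⁻ (_∈? proj₁ top) {xs = allFin n} z∈)) ∉⊥

  -- Increasing chains with respect to a fixed total order.

  module _ {_⊑_ : Rel (Fin n) ℓ} (isTotalOrder : IsTotalOrder _≡_ _⊑_) where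

    open IsTotalOrder isTotalOrder using (antisym; total)
      renaming (refl to ⊑-refl; trans to ⊑-trans)
    open ToStrict _≡_ _⊑_ using () renaming (_<_ to _⊏_)

    head-⊑ : ∀ {x y xs} → Linked _⊏_ (x ∷ xs) → y ∈ˡ (x ∷ xs) → x ⊑ y
    head-⊑ inc = All.lookup (Linked⇒All ⊑-trans ⊑-refl (Linked.map proj₁ inc))

    -- Both label sequences enumerate `B ─ X`, and an increasing one starts with the minimum. So the
    -- first labels agree, hence the second sets agree, and induction applies. If one chain stops at
    -- `X`, then `B ─ X` is empty and the other stops as well.
    increasing-unique : ∀ {X Y xs ys B} (cs : Linked _⋖_ (X ∷ xs)) (ds : Linked _⋖_ (Y ∷ ys)) →
                        EndsAt B (X ∷ xs) → EndsAt B (Y ∷ ys) →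
                        Linked _⊏_ (labels cs) → Linked _⊏_ (labels ds) →
                        X ≈ Y → Pointwise _≈_ (X ∷ xs) (Y ∷ ys)
    increasing-unique [-] [-] _ _ _ _ X≈Y = X≈Y ∷ []
    increasing-unique [-] (d ∷ ds) (last refl) f _ _ refl
      with (z∈B , z∉X) ∷ _ ← labels⁻ (d ∷ ds) f = contradiction z∈B z∉X
    increasing-unique (c ∷ cs) [-] e (last refl) _ _ refl
      with (z∈B , z∉X) ∷ _ ← labels⁻ (c ∷ cs) e = contradiction z∈B z∉X
    increasing-unique {X , _} {xs = X′ ∷ _} {Y′ ∷ _} (c ∷ cs) (d ∷ ds) (next e) (next f) ic id refl =
      refl ∷ increasing-unique cs ds e f (Linked.tail ic) (Linked.tail id)
        (⊆-antisym (next-⊆ c d c≡d) (next-⊆ d c (sym c≡d)))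
      where
      c≡d : label c ≡ label d
      c≡d = antisym
        (head-⊑ ic (labels⁺ (c ∷ cs) (next e) (ends⊇ ds f (label∈ d)) (label∉ d)))
        (head-⊑ id (labels⁺ (d ∷ ds) (next f) (ends⊇ cs e (label∈ c)) (label∉ c)))

      next-⊆ : ∀ {fX gX V W} (c : (X , fX) ⋖ V) (d : (X , gX) ⋖ W) → label c ≡ label d →
               proj₁ V ⊆ proj₁ W
      next-⊆ {W = W} c d eq {z} z∈ with z ∈? X
      ... | yes z∈X = proj₁ (Covers.strict d) z∈X
      ... | no  z∉X = subst (_∈ proj₁ W) (sym (trans (≡-label c z∈ z∉X) eq)) (label∈ d)

    -- From supersolvable antimatroids to EL-labellings.

    module _ (ss : IsSupersolvableAntimatroid 𝓢 _⊑_) where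

      open IsSupersolvableAntimatroid ss using (minExchange)

      increasingChain : ∀ (A B : Feasibles) → proj₁ A ⊆ proj₁ B →
                        ∃ λ xs → Σ (Linked _⋖_ (A ∷ xs)) λ cs →
                          EndsAt B (A ∷ xs) × Linked _⊏_ (labels cs)
      increasingChain (A , fA) (B , fB) A⊆B = go A fA A⊆B (⊃-wellFounded A)
        where
        go : ∀ A (fA : Feasible A) → A ⊆ B → Acc _⊃_ A →
             ∃ λ xs → Σ (Linked _⋖_ ((A , fA) ∷ xs)) λ cs →
               EndsAt (B , fB) ((A , fA) ∷ xs) × Linked _⊏_ (labels cs)
        go A fA A⊆B (acc rec) with B ⊆? A
        ... | yes B⊆A = [] , [-] , last (⊆-antisym A⊆B B⊆A) , []
        ... | no  B⊈A
          with x , x∈B─A , x-min ← ∃-minimum 𝓢 isTotalOrder (⊈⇒nonempty-─ B⊈A)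
          with fA∪x ← minExchange fA fB B⊈A (x∈B─A , x-min)
          with xs , cs , e , inc ← go (A ∪ ⁅ x ⁆) fA∪x
                 (∪-least A⊆B (⁅x⁆⊆p (p─q⊆p B A x∈B─A)))
                 (rec (p⊆p∪q ⁅ x ⁆ , x , q⊆p∪q A ⁅ x ⁆ (x∈⁅x⁆ x) , x∈p─q⇒x∉q B A x∈B─A))
          = _ , step ∷ cs , next e , All.map below (labels⁻ cs e) ∷ᴸ inc
          where
          step : (A , fA) ⋖ (A ∪ ⁅ x ⁆ , fA∪x)
          step = ∪-singleton-covers fA fA∪x (x∈p─q⇒x∉q B A x∈B─A)
          x≡step : x ≡ label step
          x≡step = ≡-label step (q⊆p∪q A ⁅ x ⁆ (x∈⁅x⁆ x)) (x∈p─q⇒x∉q B A x∈B─A)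
          -- All later labels are elements of `B` outside `A ∪ ⁅ x ⁆`: minimality of `x` in `B ─ A`
          -- puts them above `x`, and they differ from `x` because it has already been added.
          below : ∀ {z} → z ∈ B × z ∉ A ∪ ⁅ x ⁆ → label step ⊏ z
          below (z∈B , z∉) =
              subst (_⊑ _) x≡step (x-min (x∈p∧x∉q⇒x∈p─q z∈B (z∉ ∘ p⊆p∪q ⁅ x ⁆)))
            , λ { refl → z∉ (label∈ step) }

      supersolvable⇒isSnELLabelling :
        IsSnELLabelling (feasiblePoset am) _⊑_ (naturalLabelling am)
      supersolvable⇒isSnELLabelling = record
        { permutation = filter (_∈? proj₁ top) (allFin n) ,
            filter⁺ (_∈? proj₁ top) {allFin n} (allFin⁺ n) , λ m → labels-permutation m _
        ; uniqueIncreasing = λ {A} {B} A⊆B →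
            let xs , cs , e , inc = increasingChain A B A⊆B
                m = covers⇒maximalChain _≟ᶠ_ cs e
            in A ∷ xs
             , (m , subst (Linked _⊏_) (labels-irrelevant (naturalLabelling am) cs _) inc)
             , λ (m′ , inc′) → unique A⊆B cs e inc m′ _ inc′
        }
        where
        unique : ∀ {A B xs ys} → proj₁ A ⊆ proj₁ B → (cs : Linked _⋖_ (A ∷ xs)) → EndsAt B (A ∷ xs) →
                 Linked _⊏_ (labels cs) →
                 IsMaximalChain (feasiblePoset am) (Interval (feasiblePoset am) A B) ys →
                 (ds : Linked _⋖_ ys) → Linked _⊏_ (labels ds) →
                 Pointwise _≈_ (A ∷ xs) ys
        unique {A} {B} A⊆B cs e inc m ds inc′
          with f ← maximalChain-endsAt A B A⊆B m
          with _ , _ , refl , A′≈A ← maximalChain-head A B A⊆B m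
          = increasing-unique cs ds e f inc inc′ (sym A′≈A)

      -- Initial segments and distributivity along the increasing chain.

      increasingChain-initial : ∀ {A B M xs} (cs : Linked _⋖_ (A ∷ xs)) → EndsAt B (A ∷ xs) →
                                Linked _⊏_ (labels cs) → M ∈ᶜ (A ∷ xs) →
                                ∀ {x y} → x ∈ proj₁ M → x ∉ proj₁ A →
                                y ∈ proj₁ B → y ∉ proj₁ M → x ⊑ y
      increasingChain-initial _ _ _ (here refl) x∈M x∉A _ _ = contradiction x∈M x∉A
      increasingChain-initial {M = M} {A′ ∷ _} (c ∷ cs) (next e) inc (there M∈) {x} x∈M x∉A y∈B y∉M
        with x ∈? proj₁ A′
      ... | no  x∉A′ = increasingChain-initial {M = M} cs e (Linked.tail inc) M∈ x∈M x∉A′ y∈B y∉M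
      -- At the edge where `x` enters, `x` is the first label of the remaining chain. Since `A ⊆ M`,
      -- the element `y` is also among the remaining labels.
      ... | yes x∈A′ = subst (_⊑ _) (sym (≡-label c x∈A′ x∉A))
        (head-⊑ inc (labels⁺ (c ∷ cs) (next e) y∈B (y∉M ∘ A⊆M)))
        where
        A⊆M = head-minimum {y = M} (covers⇒increasing (c ∷ cs)) (there M∈)

      -- Down-sets relative to `top`. Elements outside every feasible set never enter a chain, yet
      -- may be small in the order, so closure is demanded within `top` only.
      Initial : Pred (Subset n) ℓ
      Initial M = ∀ {x y} → x ∈ M → y ∈ proj₁ top → y ⊑ x → y ∈ M

      -- Otherwise let `x` be the minimum of `M ∩ C` outside its interior `I`. Elements of `C ─ I`
      -- below `x` lie in `M` because `M` is initial, so `x` is also the minimum of `C ─ I`. Then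
      -- `I ∪ ⁅ x ⁆` is feasible and contained in `M ∩ C`, although `I` is the largest such set.
      initial∩feasible : ∀ {M C} → Initial M → Feasible C → Feasible (M ∩ C)
      initial∩feasible {M} {C} initial fC =
        subst Feasible (⊆-antisym (interior⊆ am (M ∩ C)) M∩C⊆I) fI
        where
        I = interior am (M ∩ C)
        fI = interior-feasible am (M ∩ C)
        M∩C⊆I : M ∩ C ⊆ I
        M∩C⊆I with M ∩ C ⊆? I
        ... | yes M∩C⊆I = M∩C⊆I
        ... | no  M∩C⊈I
          with x , x∈ , x-min ← ∃-minimum 𝓢 isTotalOrder (⊈⇒nonempty-─ M∩C⊈I)
          = contradiction (interior-greatest am fI∪x I∪x⊆M∩C (q⊆p∪q I ⁅ x ⁆ (x∈⁅x⁆ x))) x∉I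
          where
          x∈M∩C = p─q⊆p (M ∩ C) I x∈
          x∉I = x∈p─q⇒x∉q (M ∩ C) I x∈
          x∈C = proj₂ (x∈p∩q⁻ M C x∈M∩C)
          minimal : ∀ {y} → y ∈ C ─ I → x ⊑ y
          minimal {y} y∈ with total x y
          ... | inj₁ x⊑y = x⊑y
          ... | inj₂ y⊑x = x-min (x∈p∧x∉q⇒x∈p─q (x∈p∩q⁺ (y∈M , y∈C)) (x∈p─q⇒x∉q C I y∈))
            where
            y∈C = p─q⊆p C I y∈
            y∈M = initial (proj₁ (x∈p∩q⁻ M C x∈M∩C)) (⊆top (C , fC) y∈C) y⊑x
          fI∪x : Feasible (I ∪ ⁅ x ⁆)
          fI∪x = minExchange fI fC (λ C⊆I → x∉I (C⊆I x∈C)) (x∈p∧x∉q⇒x∈p─q x∈C x∉I , minimal)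
          I∪x⊆M∩C : I ∪ ⁅ x ⁆ ⊆ M ∩ C
          I∪x⊆M∩C = ∪-least (interior⊆ am (M ∩ C)) (⁅x⁆⊆p x∈M∩C)

      -- Since Initial and a chain are both closed under ∩, the unions of sets
      -- M ∩ C form a ring of feasible sets.
      data InitialPieces (𝔠 : List Feasibles) : Subset n → Set ℓ where
        piece : ∀ {M C} → Initial M → C ∈ᶜ 𝔠 → InitialPieces 𝔠 (M ∩ proj₁ C)
        _∪ᵖ_  : ∀ {X Y} → InitialPieces 𝔠 X → InitialPieces 𝔠 Y → InitialPieces 𝔠 (X ∪ Y)

      pieces-feasible : ∀ {𝔠 X} → InitialPieces 𝔠 X → Feasible X
      pieces-feasible (piece {C = _ , fC} initial _) = initial∩feasible initial fC
      pieces-feasible (pX ∪ᵖ pY) = ∪-feasible am (pieces-feasible pX) (pieces-feasible pY)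

      pieces-∩ : ∀ {𝔠 X Y} → Linked _≺_ 𝔠 → InitialPieces 𝔠 X → InitialPieces 𝔠 Y →
                 InitialPieces 𝔠 (X ∩ Y)
      pieces-∩ {Y = Y} inc (_∪ᵖ_ {X₁} {X₂} p₁ p₂) pY =
        subst (InitialPieces _) (sym (∩-distribʳ-∪ Y X₁ X₂)) (pieces-∩ inc p₁ pY ∪ᵖ pieces-∩ inc p₂ pY)
      pieces-∩ {X = X} inc pX@(piece _ _) (_∪ᵖ_ {Y₁} {Y₂} p₁ p₂) =
        subst (InitialPieces _) (sym (∩-distribˡ-∪ X Y₁ Y₂)) (pieces-∩ inc pX p₁ ∪ᵖ pieces-∩ inc pX p₂)
      pieces-∩ {𝔠} inc (piece {M} {C} iM C∈) (piece {M′} {C′} iM′ C′∈) =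
        smaller (comparable {x = C} {C′} inc C∈ C′∈)
        where
        iM∩M′ : Initial (M ∩ M′)
        iM∩M′ x∈ y∈top y⊑x with x∈M , x∈M′ ← x∈p∩q⁻ M M′ x∈ =
          x∈p∩q⁺ (iM x∈M y∈top y⊑x , iM′ x∈M′ y∈top y⊑x)

        -- Here `D` stands for the smaller of the comparable sets `C` and `C′`, which is their
        -- intersection; the hypotheses are symmetric so as to serve both cases.
        regroup : ∀ {D} → D ⊆ proj₁ C → D ⊆ proj₁ C′ → proj₁ C ∩ proj₁ C′ ⊆ D →
                  (M ∩ M′) ∩ D ≡ (M ∩ proj₁ C) ∩ (M′ ∩ proj₁ C′)
        regroup {D} D⊆C D⊆C′ C∩C′⊆D = ⊆-antisym
          (λ x∈ → let x∈M∩M′ , x∈D = x∈p∩q⁻ (M ∩ M′) D x∈ ; x∈M , x∈M′ = x∈p∩q⁻ M M′ x∈M∩M′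
                  in x∈p∩q⁺ (x∈p∩q⁺ (x∈M , D⊆C x∈D) , x∈p∩q⁺ (x∈M′ , D⊆C′ x∈D)))
          (λ x∈ → let x∈₁ , x∈₂ = x∈p∩q⁻ (M ∩ proj₁ C) (M′ ∩ proj₁ C′) x∈
                      x∈M , x∈C = x∈p∩q⁻ M (proj₁ C) x∈₁ ; x∈M′ , x∈C′ = x∈p∩q⁻ M′ (proj₁ C′) x∈₂
                  in x∈p∩q⁺ (x∈p∩q⁺ (x∈M , x∈M′) , C∩C′⊆D (x∈p∩q⁺ (x∈C , x∈C′))))

        smaller : proj₁ C ⊆ proj₁ C′ ⊎ proj₁ C′ ⊆ proj₁ C →
                  InitialPieces 𝔠 ((M ∩ proj₁ C) ∩ (M′ ∩ proj₁ C′))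
        smaller (inj₁ C⊆C′) = subst (InitialPieces 𝔠)
          (regroup ⊆-refl C⊆C′ (p∩q⊆p (proj₁ C) (proj₁ C′))) (piece {C = C} iM∩M′ C∈)
        smaller (inj₂ C′⊆C) = subst (InitialPieces 𝔠)
          (regroup C′⊆C ⊆-refl (p∩q⊆q (proj₁ C) (proj₁ C′))) (piece {C = C′} iM∩M′ C′∈)

      feasible⇒interior≡ : ∀ {X} → Feasible X → interior am X ≡ X
      feasible⇒interior≡ {X} fX = ⊆-antisym (interior⊆ am X) (interior-greatest am fX ⊆-refl)

      supersolvable⇒isSupersolvableLattice : IsSupersolvableLattice (feasibleLattice am)
      supersolvable⇒isSupersolvableLattice
        with xs , cs , e , inc ← increasingChain bottom top (⊆-min (proj₁ top))
        = bottom ∷ xs , endsAtTop⇒maximalChain cs e , distributive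
        where
        distributive : ∀ 𝔠 → IsMaximalChain (feasiblePoset am) U 𝔠 →
          let module S = Lattice (sublattice (feasibleLattice am) ((_∈ᶜ (bottom ∷ xs)) ∪ₚ (_∈ᶜ 𝔠)))
          in IsDistributiveLattice S._≈_ S._≤_ S._∨_ S._∧_
        distributive 𝔠 isMax = record
          { isLattice    = S.isLattice
          ; ∧-distribˡ-∨ = λ (X , gX) (Y , gY) (Z , gZ) → distrib
              (generated⇒pieces gX) (generated⇒pieces gY) (generated⇒pieces gZ)
          }
          where
          open IsMaximalChain isMax using (increasing; maximal)
          S = (_∈ᶜ (bottom ∷ xs)) ∪ₚ (_∈ᶜ 𝔠)
          module S = Lattice (sublattice (feasibleLattice am) S)

          interior-∩ : ∀ {X Y} → InitialPieces 𝔠 X → InitialPieces 𝔠 Y → interior am (X ∩ Y) ≡ X ∩ Y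
          interior-∩ pX pY = feasible⇒interior≡ (pieces-feasible (pieces-∩ increasing pX pY))

          top∈𝔠 : top ∈ᶜ 𝔠
          top∈𝔠 = maximal {top} _ (All.universal (λ C → inj₂ λ {_} → ⊆top C) 𝔠)

          chain-initial : ∀ {M} → M ∈ᶜ (bottom ∷ xs) → Initial (proj₁ M)
          chain-initial {M} M∈ {x} {y} x∈M y∈top y⊑x with y ∈? proj₁ M
          ... | yes y∈M = y∈M
          -- If `y` entered after `x`, increasing labels would give `x ⊑ y`, hence `x ≡ y`, which
          -- already lies in `M`.
          ... | no  y∉M = subst (_∈ proj₁ M)
            (antisym (increasingChain-initial {M = M} cs e inc M∈ x∈M ∉⊥ y∈top y∉M) y⊑x) x∈M

          generated⇒pieces : ∀ {X} → Generated (feasibleLattice am) S X → InitialPieces 𝔠 (proj₁ X)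
          -- Each generator is a single piece: a member `M` of the M-chain is `M ∩ top`, and a
          -- member `C` of `𝔠` is `⊤ ∩ C`.
          generated⇒pieces (gen {M} (inj₁ M∈)) = subst (InitialPieces 𝔠)
            (⊆-antisym (p∩q⊆p (proj₁ M) (proj₁ top)) (λ x∈M → x∈p∩q⁺ (x∈M , ⊆top M x∈M)))
            (piece {C = top} (chain-initial {M} M∈) top∈𝔠)
          generated⇒pieces (gen {C} (inj₂ C∈)) = subst (InitialPieces 𝔠)
            (∩-identityˡ (proj₁ C)) (piece {C = C} (λ _ _ _ → ∈⊤) C∈)
          generated⇒pieces (gX ∨ᵍ gY) = generated⇒pieces gX ∪ᵖ generated⇒pieces gY
          -- The intersection of two unions of pieces is again one, hence feasible, so taking the
          -- interior changes nothing.
          generated⇒pieces (gX ∧ᵍ gY) = subst (InitialPieces 𝔠) (sym (interior-∩ pX pY))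
            (pieces-∩ increasing pX pY)
            where
            pX = generated⇒pieces gX
            pY = generated⇒pieces gY

          distrib : ∀ {X Y Z} → InitialPieces 𝔠 X → InitialPieces 𝔠 Y → InitialPieces 𝔠 Z →
                    interior am (X ∩ (Y ∪ Z)) ≡ interior am (X ∩ Y) ∪ interior am (X ∩ Z)
          distrib {X} {Y} {Z} pX pY pZ = trans (interior-∩ pX (pY ∪ᵖ pZ))
            (trans (∩-distribˡ-∪ X Y Z) (sym (cong₂ _∪_ (interior-∩ pX pY) (interior-∩ pX pZ))))

    -- From EL-labellings to supersolvable antimatroids.

    isSnELLabelling⇒supersolvable :
      IsSnELLabelling (feasiblePoset am) _⊑_ (naturalLabelling am) →
      IsSupersolvableAntimatroid 𝓢 _⊑_
    isSnELLabelling⇒supersolvable el = record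
      { ∅-feasible  = ∅-feasible
      ; minExchange = λ fA fB B⊈A isMin → minExchange fA fB B⊈A isMin
      }
      where
      open IsSnELLabelling el using (uniqueIncreasing)

      minExchange : ∀ {A B} → Feasible A → Feasible B → B ⊈ A →
                    ∀ {x} → IsMinimum 𝓢 _⊑_ (B ─ A) x → Feasible (A ∪ ⁅ x ⁆)
      minExchange {A} {B} fA fB B⊈A {x} (x∈B─A , x-min)
        with A⊆A∪B ← p⊆p∪q {p = A} B
        with xs , (m , inc) , _ ← uniqueIncreasing {A , fA} {A ∪ B , ∪-feasible am fA fB} A⊆A∪B
        = first _ inc
            (maximalChain-head (A , fA) (A ∪ B , ∪-feasible am fA fB) A⊆A∪B m)
            (maximalChain-endsAt (A , fA) (A ∪ B , ∪-feasible am fA fB) A⊆A∪B m)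
        where
        A∪B : Feasibles
        A∪B = A ∪ B , ∪-feasible am fA fB
        first : ∀ {xs} (cs : Linked _⋖_ xs) → Linked _⊏_ (labels cs) →
                (∃ λ A′ → ∃ λ xs′ → xs ≡ A′ ∷ xs′ × proj₁ A′ ≡ A) →
                EndsAt A∪B xs → Feasible (A ∪ ⁅ x ⁆)
        first [-] _ (_ , _ , refl , refl) (last A≡A∪B) =
          ⊥-elim (B⊈A (λ z∈B → subst (_ ∈_) (sym A≡A∪B) (q⊆p∪q A B z∈B)))
        first {_ ∷ (Y , fY) ∷ _} (c ∷ cs) inc (_ , _ , refl , refl) (next e) =
          subst Feasible (⊆-antisym Y⊆A∪x (∪-least (proj₁ (Covers.strict c)) (⁅x⁆⊆p x∈Y))) fY
          where
          c∈B : label c ∈ B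
          c∈B with x∈p∪q⁻ A B (ends⊇ cs e (label∈ c))
          ... | inj₁ c∈A = contradiction c∈A (label∉ c)
          ... | inj₂ c∈B = c∈B
          x≡c : x ≡ label c
          -- The first label lies in `B ─ A`, so it is at least `x`; conversely `x` occurs among the
          -- labels of the chain from `A` to `A ∪ B`, so it is at least the first one.
          x≡c = antisym (x-min (x∈p∧x∉q⇒x∈p─q c∈B (label∉ c)))
            (head-⊑ inc (labels⁺ (c ∷ cs) (next e) (q⊆p∪q A B (p─q⊆p B A x∈B─A)) (x∈p─q⇒x∉q B A x∈B─A)))
          x∈Y : x ∈ Y
          x∈Y = subst (_∈ Y) (sym x≡c) (label∈ c)
          Y⊆A∪x : Y ⊆ A ∪ ⁅ x ⁆
          Y⊆A∪x {z} z∈Y with z ∈? A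
          ... | yes z∈A = p⊆p∪q ⁅ x ⁆ z∈A
          ... | no  z∉A = q⊆p∪q A ⁅ x ⁆
            (subst (_∈ ⁅ x ⁆) (trans x≡c (sym (≡-label c z∈Y z∉A))) (x∈⁅x⁆ x))

  -- Chains through a given feasible set and the edges at which elements enter.

  coverAdding : ∀ {X xs B x} → Linked _⋖_ (X ∷ xs) → B ∈ᶜ (X ∷ xs) → x ∈ proj₁ B → x ∉ proj₁ X →
                ∃ λ Y → ∃ λ Z → Y ∈ᶜ (X ∷ xs) × Z ∈ᶜ (X ∷ xs) × Y ⋖ Z ×
                  x ∉ proj₁ Y × x ∈ proj₁ Z × proj₁ Z ⊆ proj₁ B
  coverAdding _ (here refl) x∈B x∉X = contradiction x∈B x∉X
  coverAdding {X} {X′ ∷ _} {B} {x} (c ∷ cs) (there B∈) x∈B x∉X with x ∈? proj₁ X′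
  -- This is the first set of the chain that contains `x`; as `B` comes no earlier, it lies inside
  -- `B`.
  ... | yes x∈X′ = X , X′ , here refl , there (here refl) , c , x∉X , x∈X′ ,
                   head-minimum {y = B} (covers⇒increasing cs) B∈
  ... | no  x∉X′ with Y , Z , Y∈ , Z∈ , rest ← coverAdding {B = B} cs B∈ x∈B x∉X′ =
    Y , Z , there Y∈ , there Z∈ , rest

  chainExtension : ∀ {A B T : Feasibles} {ys} → proj₁ A ⊆ proj₁ B →
                   Linked _⋖_ (B ∷ ys) → EndsAt T (B ∷ ys) →
                   ∃ λ xs → Linked _⋖_ (A ∷ xs) × EndsAt T (A ∷ xs) × B ∈ᶜ (A ∷ xs)
  chainExtension {A , fA} {B , fB} {T} {ys} A⊆B cs e = go A fA A⊆B (⊃-wellFounded A)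
    where
    go : ∀ A (fA : Feasible A) → A ⊆ B → Acc _⊃_ A →
         ∃ λ xs → Linked _⋖_ ((A , fA) ∷ xs) × EndsAt T ((A , fA) ∷ xs) × (B , fB) ∈ᶜ ((A , fA) ∷ xs)
    go A fA A⊆B (acc rec) with B ⊆? A
    ... | yes B⊆A with refl ← ⊆-antisym A⊆B B⊆A = ys , relink cs , reend e , here refl
      where
      -- The two heads carry possibly different proofs of feasibility for the same set. Covers
      -- depend on the sets alone, so repacking the first edge suffices.
      relink : ∀ {ys} → Linked _⋖_ ((B , fB) ∷ ys) → Linked _⋖_ ((B , fA) ∷ ys)
      relink [-] = [-]
      relink ((strict , nothingBetween) ∷ cs) = (strict , nothingBetween) ∷ cs
      reend : ∀ {ys} → EndsAt T ((B , fB) ∷ ys) → EndsAt T ((B , fA) ∷ ys)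
      reend (last eq) = last eq
      reend (next e) = next e
    ... | no B⊈A
      with x , x∈B─A , fA∪x ← exchange fA fB B⊈A
      with xs , ds , f , B∈ ← go (A ∪ ⁅ x ⁆) fA∪x
             (∪-least A⊆B (⁅x⁆⊆p (p─q⊆p B A x∈B─A)))
             (rec (p⊆p∪q ⁅ x ⁆ , x , q⊆p∪q A ⁅ x ⁆ (x∈⁅x⁆ x) , x∈p─q⇒x∉q B A x∈B─A))
      = _ , ∪-singleton-covers fA fA∪x (x∈p─q⇒x∉q B A x∈B─A) ∷ ds , next f , there B∈

  -- Assembled from the upper end: a saturated chain from `B` to `top`, then one from `bottom` to
  -- `B` put in front of it.
  chainThrough : ∀ (B : Feasibles) →
                 ∃ λ xs → Linked _⋖_ (bottom ∷ xs) × EndsAt top (bottom ∷ xs) × B ∈ᶜ (bottom ∷ xs)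
  chainThrough B
    with _ , cs , e , _ ← chainExtension {B} {top} {top} (⊆top B) [-] (last refl)
    = chainExtension {bottom} {B} (⊆-min (proj₁ B)) cs e

  -- From an M-chain to a total order on the ground set.

  module _ (supersolvable : IsSupersolvableLattice (feasibleLattice am)) where

    private
      𝔪 = proj₁ supersolvable
      𝔪-maximal = proj₁ (proj₂ supersolvable)
      𝔪-distributive = proj₂ (proj₂ supersolvable)

    -- Not injective: elements of E in no feasible set all have rank length 𝔪.
    rank : Fin n → ℕ
    rank x = length (filter (λ M → ¬? (x ∈? proj₁ M)) 𝔪)

    -- A member of the chain that misses `y` cannot contain `M`, so it is contained in `M` and
    -- misses `x` too. The set `M` itself misses `x` but not `y`, which makes the count strict.
    rank-< : ∀ {M x y} → M ∈ᶜ 𝔪 → y ∈ proj₁ M → x ∉ proj₁ M → rank y < rank x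
    rank-< {M} {x} {y} M∈ y∈M x∉M =
      filter-length-< (λ M → ¬? (y ∈? proj₁ M)) (λ M → ¬? (x ∈? proj₁ M))
        (All.tabulate implies) (Any.map (λ {M′} → separates {M′}) M∈)
      where
      open IsMaximalChain 𝔪-maximal using (increasing)
      implies : ∀ {M′} → M′ ∈ˡ 𝔪 → y ∉ proj₁ M′ → x ∉ proj₁ M′
      implies {M′} M′∈ y∉M′ x∈M′
        with comparable {x = M} {M′} increasing M∈ (Any.map (cong proj₁) M′∈)
      ... | inj₁ M⊆M′ = y∉M′ (M⊆M′ y∈M)
      ... | inj₂ M′⊆M = x∉M (M′⊆M x∈M′)
      separates : ∀ {M′} → M ≈ M′ → ¬ (y ∉ proj₁ M′) × x ∉ proj₁ M′
      separates refl = (λ y∉M → y∉M y∈M) , x∉M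

    coverAddingInMChain : ∀ x → x ∈ proj₁ top →
                          ∃ λ Y → ∃ λ Z → Y ∈ᶜ 𝔪 × Z ∈ᶜ 𝔪 × Y ⋖ Z × x ∉ proj₁ Y × x ∈ proj₁ Z
    coverAddingInMChain x x∈top
      with isMax′ ← maximalChain-bounds 𝔪-maximal
      with cs ← maximalChain⇒covers (feasiblePoset am)
                (λ {X} {Y} {Z} → U-convex (feasiblePoset am) {X} {Y} {Z}) 𝔪-maximal
      with e ← maximalChain-endsAt bottom top (⊆-min (proj₁ top)) isMax′
      with _ , _ , eq , refl ← maximalChain-head bottom top (⊆-min (proj₁ top)) isMax′
      rewrite eq
      with Y , Z , Y∈ , Z∈ , c , x∉Y , x∈Z , _ ← coverAdding {B = top} cs (endsAt⇒∈ e) x∈top ∉⊥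
      = Y , Z , Y∈ , Z∈ , c , x∉Y , x∈Z

    -- Passing from `B` to the member `C` of `𝔠` at which `x` enters makes the situation symmetric:
    -- `C′ ⋖ C` and `M′ ⋖ M` add the same single element, and all four sets lie in the distributive
    -- sublattice.
    ∈-meet : ∀ {B M′ M x} → M′ ∈ᶜ 𝔪 → M ∈ᶜ 𝔪 → M′ ⋖ M → x ∈ proj₁ M → x ∉ proj₁ M′ →
             x ∈ proj₁ B → x ∈ interior am (proj₁ B ∩ proj₁ M)
    ∈-meet {B} {M′} {M} {x} M′∈ M∈ m x∈M x∉M′ x∈B
      with xs , cs , e , B∈ ← chainThrough B
      with C′ , C , C′∈ , C∈ , c , x∉C′ , x∈C , C⊆B ← coverAdding {B = B} cs B∈ x∈B ∉⊥
      = conclude (x∈p∪q⁻ (proj₁ J) (interior am (proj₁ C ∩ proj₁ M)) x∈lhs)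
      where
      𝔠 = bottom ∷ xs
      S = (_∈ᶜ 𝔪) ∪ₚ (_∈ᶜ 𝔠)
      D : DistributiveLattice 0ℓ 0ℓ 0ℓ
      D = record { isDistributiveLattice = 𝔪-distributive 𝔠 (endsAtTop⇒maximalChain cs e) }
      open DistributiveLatticeProperties D using (∨-distribˡ-∧)

      J : Feasibles
      J = proj₁ C′ ∪ proj₁ M′ , ∪-feasible am (proj₂ C′) (proj₂ M′)

      gen-J : Generated (feasibleLattice am) S J
      gen-J = gen {x = C′} (inj₂ C′∈) ∨ᵍ gen {x = M′} (inj₁ M′∈)

      -- The only element of `C` outside `C′` is `x`, which lies in `M`. Hence `J ∨ C` is below
      -- `J ∨ M`, their meet is `J ∨ C`, and this contains `x`.
      C⊆J∪M : proj₁ C ⊆ proj₁ J ∪ proj₁ M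
      C⊆J∪M {z} z∈C with z ∈? proj₁ C′
      ... | yes z∈C′ = p⊆p∪q (proj₁ M) (p⊆p∪q (proj₁ M′) z∈C′)
      ... | no  z∉C′ = q⊆p∪q (proj₁ J) (proj₁ M)
        (subst (_∈ proj₁ M) (trans (≡-label c x∈C x∉C′) (sym (≡-label c z∈C z∉C′))) x∈M)

      x∈lhs : x ∈ proj₁ J ∪ interior am (proj₁ C ∩ proj₁ M)
      x∈lhs = subst (x ∈_)
        (sym (∨-distribˡ-∧ (J , gen-J) (C , gen (inj₂ C∈)) (M , gen (inj₁ M∈))))
        (interior-greatest am (∪-feasible am (proj₂ J) (proj₂ C))
          (λ z∈ → x∈p∩q⁺ (z∈ , ∪-least (p⊆p∪q (proj₁ M)) C⊆J∪M z∈))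
          (q⊆p∪q (proj₁ J) (proj₁ C) x∈C))

      conclude : x ∈ proj₁ J ⊎ x ∈ interior am (proj₁ C ∩ proj₁ M) →
                 x ∈ interior am (proj₁ B ∩ proj₁ M)
      conclude (inj₂ x∈) = interior-greatest am (interior-feasible am (proj₁ C ∩ proj₁ M))
        (λ z∈ → let z∈C , z∈M = x∈p∩q⁻ (proj₁ C) (proj₁ M) (interior⊆ am (proj₁ C ∩ proj₁ M) z∈)
                in x∈p∩q⁺ (C⊆B z∈C , z∈M)) x∈
      conclude (inj₁ x∈J) with x∈p∪q⁻ (proj₁ C′) (proj₁ M′) x∈J
      ... | inj₁ x∈C′ = contradiction x∈C′ x∉C′
      ... | inj₂ x∈M′ = contradiction x∈M′ x∉M′

    isSupersolvableLattice⇒supersolvable :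
      IsSupersolvableAntimatroid 𝓢 (TieBroken rank)
    isSupersolvableLattice⇒supersolvable = record
      { ∅-feasible  = ∅-feasible
      ; minExchange = λ fA fB _ isMin → minExchange fA fB isMin
      }
      where
      minExchange : ∀ {A B} → Feasible A → Feasible B →
                    ∀ {x} → IsMinimum 𝓢 (TieBroken rank) (B ─ A) x → Feasible (A ∪ ⁅ x ⁆)
      minExchange {A} {B} fA fB {x} (x∈B─A , x-min)
        with x∈B ← p─q⊆p B A x∈B─A
        with M′ , M , M′∈ , M∈ , m , x∉M′ , x∈M ← coverAddingInMChain x (⊆top (B , fB) x∈B)
        = subst Feasible (⊆-antisym (∪-least (p⊆p∪q ⁅ x ⁆) I⊆A∪x) (∪-least (p⊆p∪q I) (⁅x⁆⊆p x∈A∪I)))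
            (∪-feasible am fA (interior-feasible am (B ∩ proj₁ M)))
        where
        I = interior am (B ∩ proj₁ M)

        x∈A∪I : x ∈ A ∪ I
        x∈A∪I = q⊆p∪q A I (∈-meet {B , fB} {M′} {M} M′∈ M∈ m x∈M x∉M′ x∈B)

        I⊆A∪x : I ⊆ A ∪ ⁅ x ⁆
        I⊆A∪x {z} z∈I with z∈B , z∈M ← x∈p∩q⁻ B (proj₁ M) (interior⊆ am (B ∩ proj₁ M) z∈I)
                      with z ∈? A | z ∈? proj₁ M′
        ... | yes z∈A | _ = p⊆p∪q ⁅ x ⁆ z∈A
        -- Such a `z` enters the M-chain before `x` and has smaller rank, against the minimality of
        -- `x` in `B ─ A`. In the remaining case `z` is added by the same edge `M′ ⋖ M` as `x` and
        -- so equals it.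
        ... | no  z∉A | yes z∈M′ = contradiction
          (tieBroken⇒≤ {r = rank} (x-min (x∈p∧x∉q⇒x∈p─q z∈B z∉A))) (ℕ.<⇒≱ (rank-< {M′} M′∈ z∈M′ x∉M′))
        ... | no  _   | no  z∉M′ = q⊆p∪q A ⁅ x ⁆
          (subst (_∈ ⁅ x ⁆) (trans (≡-label m x∈M x∉M′) (sym (≡-label m z∈M z∉M′))) (x∈⁅x⁆ x))

theorem2p13 : ∀ {n} (𝓢 : SetSystem n) (am : IsAntimatroid 𝓢) →
    ((Σ (Rel (Fin n) 0ℓ) λ _≤_ →
    IsTotalOrder _≡_ _≤_ × IsSupersolvableAntimatroid 𝓢 _≤_)
    ⇔ IsSupersolvableLattice (feasibleLattice am))
    ×
    (IsSupersolvableLattice (feasibleLattice am)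
    ⇔ (Σ (Rel (Fin n) 0ℓ) λ _≤_ →
    IsTotalOrder _≡_ _≤_
    × IsSnELLabelling (feasiblePoset am) _≤_ (naturalLabelling am)))
theorem2p13 𝓢 am = 1⇔2 , 1⇔3 ⇔-∘ ⇔-sym 1⇔2
  where
  1⇔2 = mk⇔
    (λ (_ , total , ss) → supersolvable⇒isSupersolvableLattice am total ss)
    (λ sl → TieBroken (rank am sl) , tieBroken-isTotalOrder (rank am sl) ,
            isSupersolvableLattice⇒supersolvable am sl)
  -- Statements 1 and 3 are equivalent for each fixed order; only the passage from the lattice has
  -- to construct one.
  1⇔3 = mk⇔
    (λ (_≤_ , total , ss) → _≤_ , total , supersolvable⇒isSnELLabelling am total ss)
    (λ (_≤_ , total , el) → _≤_ , total , isSnELLabelling⇒supersolvable am total el)
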